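{- Let $n\ge 2$. The number of narcissistic preference profiles $(\succ_1,\succ_2,\dots,\succ_n)$ for the voter set $\mathcal{V}=\{1,2,\dots,n\}$ that are single-peaked with respect to the linear order $1\triangleright 2\triangleright\cdots\triangleright n$ is $\prod_{2\le i\le n-1}\binom{n-1}{i-1}$.
   Context: Let $\mathcal{V}=\{1,2,\dots,n\}$ be a set of voters, which is also the set of alternatives. A preference order $\succ$ on $\mathcal{V}$ is a strict linear order on $\mathcal{V}$; $a\succ b$ means $a$ is preferred to $b$. A preference profile for $\mathcal{V}$ is an $n$-tuple $(\succ_1,\dots,\succ_n)$ of preference orders on $\mathcal{V}$, where $\succ_i$ is the preference order of voter $i$. Let $\mathrm{peak}(\succ)$ denote the most preferred alternative in $\succ$. A profile is narcissistic if $\mathrm{peak}(\succ_i)=i$ for every voter $i\in\mathcal{V}$. Given a (strict) linear order $\triangleright$ on $\mathcal{V}$, a preference order $\succ$ is single-peaked with respect to $\triangleright$ if for every two alternatives $a,b\in\mathcal{V}$: if $a\triangleright b\triangleright \mathrm{peak}(\succ)$ or $\mathrm{peak}(\succ)\triangleright b\triangleright a$, then $b\succ a$. A profile is single-peaked with respect to $\triangleright$ if each of its preference orders is. Profiles are counted as $n$-tuples (distinct tuples are distinct profiles); an empty product equals $1$. -}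

module Defs where

open import Data.Fin as Fin using (Fin; zero; suc)
open import Data.Fin.Properties using (<-isStrictTotalOrder)
open import Data.List using (map; product; applyUpTo)
open import Data.Nat using (ℕ; suc; _+_; _∸_)
open import Data.Product using (∃; ∃!; _×_; _,_; proj₁; swap)
open import Data.Sum using (_⊎_)
open import Data.Vec.Functional using (Vector)
import Data.Vec.Functional.Relation.Binary.Pointwise.Properties as Pointwise
open import Function using (_∘_; id)
open import Function.Bundles using (Bijection)
open import Level using (Level; 0ℓ; _⊔_) renaming (suc to lsuc)
open import Relation.Binary using (Rel; Setoid; IsStrictTotalOrder; tri<; tri≈; tri>; _⇔_)
import Relation.Binary.Construct.On as On
open import Relation.Binary.PropositionalEquality as ≡ using (_≡_; _≢_; refl)
open import Relation.Nullary using (yes; no; contradiction)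

-- Fin n is both the set of voters and the set of alternatives.

record LinearOrder (n : ℕ) : Set₁ where
  field
    _≻_                : Rel (Fin n) 0ℓ
    isStrictTotalOrder : IsStrictTotalOrder _≡_ _≻_

  open IsStrictTotalOrder isStrictTotalOrder public
    using (compare; trans; asym)

-- x ≻ y is read "x is preferred to y".
PreferenceOrder : ℕ → Set₁
PreferenceOrder = LinearOrder

-- Two orders are the same when they are the same relation.
linearOrderSetoid : ℕ → Setoid (lsuc 0ℓ) 0ℓ
linearOrderSetoid n = record
  { Carrier       = LinearOrder n
  ; _≈_           = λ P Q → LinearOrder._≻_ P ⇔ LinearOrder._≻_ Q
  ; isEquivalence = record
    { refl  = id , id
    ; sym   = swap
    ; trans = λ (f , f′) (g , g′) → g ∘ f , f′ ∘ g′
    }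
  }

Profile : ℕ → Set₁
Profile n = Vector (PreferenceOrder n) n

profileSetoid : ℕ → Setoid (lsuc 0ℓ) 0ℓ
profileSetoid n = Pointwise.setoid (linearOrderSetoid n) n

module _ {n : ℕ} where

  IsPeak : PreferenceOrder n → Fin n → Set
  IsPeak P p = ∀ {a} → a ≢ p → p ≻ a
    where open LinearOrder P

  Narcissistic : Profile n → Set
  Narcissistic Ps = ∀ i → IsPeak (Ps i) i

  SinglePeakedOrder : LinearOrder n → PreferenceOrder n → Set
  SinglePeakedOrder axis P =
    ∀ {p} → IsPeak P p → ∀ a b →
    ((a ▷ b) × (b ▷ p)) ⊎ ((p ▷ b) × (b ▷ a)) → b ≻ a
    where
    open LinearOrder axis using () renaming (_≻_ to _▷_)
    open LinearOrder P using (_≻_)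

  SinglePeaked : LinearOrder n → Profile n → Set
  SinglePeaked axis Ps = ∀ i → SinglePeakedOrder axis (Ps i)

-- IsPeak determines exactly one alternative, so quantifying over all peaks in
-- SinglePeakedOrder amounts to speaking of the peak.
peak! : ∀ {m} (P : PreferenceOrder (suc m)) → ∃! _≡_ (IsPeak P)
peak! {m} P = let p , p-peak = best id in p , (λ {a} → p-peak a) , unique (λ {a} → p-peak a)
  where
  open LinearOrder P

  best : ∀ {k} (f : Fin (suc k) → Fin (suc m)) →
         ∃ λ p → ∀ i → f i ≢ p → p ≻ f i
  best {0} f = f zero , λ { zero f0≢f0 → contradiction refl f0≢f0 }
  best {suc k} f with best (f ∘ suc)
  ... | p , p-best with compare (f zero) p
  ...   | tri< f0≻p _ _ = f zero , λ
    { zero    f0≢f0 → contradiction refl f0≢f0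
    ; (suc i) _     → beats i
    }
    where
    beats : ∀ i → f zero ≻ f (suc i)
    beats i with f (suc i) Fin.≟ p
    ... | yes eq = ≡.subst (f zero ≻_) (≡.sym eq) f0≻p
    ... | no ne  = trans f0≻p (p-best i ne)
  ...   | tri≈ _ f0≡p _ = p , λ
    { zero    f0≢p → contradiction f0≡p f0≢p
    ; (suc i)      → p-best i
    }
  ...   | tri> _ _ p≻f0 = p , λ
    { zero    _ → p≻f0
    ; (suc i)   → p-best i
    }

  unique : ∀ {p q} → IsPeak P p → IsPeak P q → p ≡ q
  unique {p} {q} p-peak q-peak with p Fin.≟ q
  ... | yes p≡q = p≡q
  ... | no  p≢q = contradiction (p-peak (p≢q ∘ ≡.sym)) (asym (q-peak p≢q))

-- 1 ▷ 2 ▷ ⋯ ▷ n: here i ▷ j means i < j.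
naturalAxis : ∀ n → LinearOrder n
naturalAxis n = record
  { _≻_                = Fin._<_
  ; isStrictTotalOrder = <-isStrictTotalOrder
  }

-- The proof components are ignored by the equality, so distinct elements are
-- distinct profiles.
narcissisticSinglePeakedProfiles : (n : ℕ) → LinearOrder n → Setoid (lsuc 0ℓ) 0ℓ
narcissisticSinglePeakedProfiles n axis =
  On.setoid {B = ∃ λ Ps → Narcissistic Ps × SinglePeaked axis Ps}
            (profileSetoid n) proj₁

HasCardinality : ∀ {c ℓ : Level} → Setoid c ℓ → ℕ → Set (c ⊔ ℓ)
HasCardinality S k = Bijection (≡.setoid (Fin k)) S

-- The product of f i over a ≤ i ≤ b, which is 1 when b < a.
∏[_⋯_] : ℕ → ℕ → (ℕ → ℕ) → ℕ
∏[ a ⋯ b ] f = product (map f (applyUpTo (a +_) (suc b ∸ a)))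

{-# OPTIONS --safe #-}

-- A preference order with peak i that is single-peaked with respect to the
-- natural axis ranks the alternatives on either side of i by their distance to
-- i, so it amounts to a shuffle of the chain of the i − 1 alternatives below i
-- and the chain of the n − i alternatives above i.  There are (n−1) C (i−1)
-- shuffles.  The voters' orders are chosen independently, and the factors for
-- i = 1 and i = n are 1.

module Submission where

open import Defs
open import Data.Fin as Fin using (Fin; zero; suc; toℕ; opposite; remQuot; combine)
open import Data.Fin.Properties as Fin
  using (+↔⊎; opposite-prop; opposite-involutive; toℕ<n; toℕ≤pred[n];
         remQuot-combine; combine-remQuot)
open import Data.List using (_∷_; []; _∷ʳ_; map; applyUpTo)
open import Data.List.Properties using (map-applyUpTo; applyUpTo-∷ʳ)
open import Data.Nat using (ℕ; zero; suc; _+_; _*_; _≤_; _<_; _∸_; z≤n; s≤s; z<s; s<s; s<s⁻¹)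
open import Data.Nat.Combinatorics using (_C_; nCn≡1; nCk+nC[k+1]≡[n+1]C[k+1])
open import Data.Nat.ListAction using (product)
open import Data.Nat.ListAction.Properties using (product-++)
open import Data.Nat.Properties as ℕ
  using (+-suc; +-identityʳ; *-identityʳ; m+[n∸m]≡n; ∸-monoʳ-<)
open import Data.Product using (∃; _×_; _,_; proj₁; proj₂)
open import Data.Sum using (inj₁; inj₂)
open import Data.Sum.Function.Propositional using (_⊎-↔_)
open import Function using (_∘_; id; case_of_)
open import Function.Bundles using (_↔_; Inverse; Injection; mk↔ₛ′)
open import Function.Properties.Inverse using (↔-trans; ↔⇒↣)
open import Relation.Binary using (tri<; tri≈; tri>)
import Relation.Binary.Morphism.OrderMonomorphism as OrderMonomorphism
open import Relation.Binary.PropositionalEquality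
open import Relation.Nullary using (¬_; Dec; yes; no; contradiction)

private
  variable
    l r m n : ℕ

-- Strictly monotone maps on `Fin n` and its reversal.

module _ (f : Fin n → ℕ) (mono : ∀ {a b} → a Fin.< b → f a < f b) where

  mono⇒cancel : ∀ {a b} → f a < f b → a Fin.< b
  mono⇒cancel {a} {b} fa<fb with Fin.<-cmp a b
  ... | tri< a<b _ _  = a<b
  ... | tri≈ _ refl _ = contradiction fa<fb (ℕ.<-irrefl refl)
  ... | tri> _ _ b<a  = contradiction fa<fb (ℕ.<-asym (mono b<a))

  mono⇒injective : ∀ {a b} → f a ≡ f b → a ≡ b
  mono⇒injective {a} {b} fa≡fb with Fin.<-cmp a b
  ... | tri< a<b _ _ = contradiction fa≡fb (ℕ.<⇒≢ (mono a<b))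
  ... | tri≈ _ a≡b _ = a≡b
  ... | tri> _ _ b<a = contradiction (sym fa≡fb) (ℕ.<⇒≢ (mono b<a))

opposite-anti-< : {a b : Fin n} → a Fin.< b → opposite b Fin.< opposite a
opposite-anti-< {a = a} {b} a<b rewrite opposite-prop a | opposite-prop b =
  ∸-monoʳ-< (s<s a<b) (toℕ<n b)

opposite-cancel-< : {a b : Fin n} → opposite a Fin.< opposite b → b Fin.< a
opposite-cancel-< {a = a} {b} oa<ob =
  subst₂ Fin._<_ (opposite-involutive b) (opposite-involutive a) (opposite-anti-< oa<ob)

opposite-injective : {a b : Fin n} → opposite a ≡ opposite b → a ≡ b
opposite-injective {a = a} {b} eq =
  trans (sym (opposite-involutive a)) (trans (cong opposite eq) (opposite-involutive b))

-- Shuffles of two chains and their number.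

-- Read from best to worst.
data Shuffle : ℕ → ℕ → Set where
  []    : Shuffle 0 0
  left  : Shuffle l r → Shuffle (suc l) r
  right : Shuffle l r → Shuffle l (suc r)

countShuffles : ℕ → ℕ → ℕ
countShuffles zero    zero    = 1
countShuffles zero    (suc r) = countShuffles zero r
countShuffles (suc l) zero    = countShuffles l zero
countShuffles (suc l) (suc r) = countShuffles l (suc r) + countShuffles (suc l) r

-- Splitting by the first entry is Pascal's rule. When one chain is empty there is a single shuffle,
-- and the binomial coefficient is 1.
countShuffles≡C : ∀ l r → countShuffles l r ≡ (l + r) C l
countShuffles≡C zero    zero    = refl
countShuffles≡C zero    (suc r) = countShuffles≡C zero r
countShuffles≡C (suc l) zero    = begin
  countShuffles l 0     ≡⟨ countShuffles≡C l 0 ⟩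
  (l + 0) C l           ≡⟨ cong (_C l) (+-identityʳ l) ⟩
  l C l                 ≡⟨ nCn≡1 l ⟩
  1                     ≡⟨ nCn≡1 (suc l) ⟨
  suc l C suc l         ≡⟨ cong (λ k → suc k C suc l) (+-identityʳ l) ⟨
  suc (l + 0) C suc l   ∎
  where open ≡-Reasoning
countShuffles≡C (suc l) (suc r) = begin
  countShuffles l (suc r) + countShuffles (suc l) r
    ≡⟨ cong₂ _+_ (countShuffles≡C l (suc r)) (countShuffles≡C (suc l) r) ⟩
  (l + suc r) C l + suc (l + r) C suc l
    ≡⟨ cong (λ k → (l + suc r) C l + k C suc l) (+-suc l r) ⟨
  (l + suc r) C l + (l + suc r) C suc l
    ≡⟨ nCk+nC[k+1]≡[n+1]C[k+1] (l + suc r) l ⟩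
  suc (l + suc r) C suc l ∎
  where open ≡-Reasoning

-- The clauses follow the recursion of `countShuffles`: a sum of counts becomes a disjoint union
-- according to the first entry.
Fin↔Shuffle : ∀ l r → Fin (countShuffles l r) ↔ Shuffle l r
Fin↔Shuffle zero    zero    =
  mk↔ₛ′ (λ _ → []) (λ _ → zero) (λ { [] → refl }) (λ { zero → refl })
Fin↔Shuffle zero    (suc r) = ↔-trans (Fin↔Shuffle zero r)
  (mk↔ₛ′ right (λ { (right s) → s }) (λ { (right _) → refl }) (λ _ → refl))
Fin↔Shuffle (suc l) zero    = ↔-trans (Fin↔Shuffle l zero)
  (mk↔ₛ′ left (λ { (left s) → s }) (λ { (left _) → refl }) (λ _ → refl))
Fin↔Shuffle (suc l) (suc r) =
  ↔-trans +↔⊎ (↔-trans (Fin↔Shuffle l (suc r) ⊎-↔ Fin↔Shuffle (suc l) r)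
  (mk↔ₛ′ (λ { (inj₁ s) → left s ; (inj₂ s) → right s })
         (λ { (left s) → inj₁ s ; (right s) → inj₂ s })
         (λ { (left _) → refl ; (right _) → refl })
         (λ { (inj₁ _) → refl ; (inj₂ _) → refl })))

-- Ranks in a shuffle, and shuffles from comparisons.

-- Position in the merged chain, with 0 the best. The index counts along the left chain from its
-- best element, so for a voter it counts outwards from the peak.
rankˡ : Shuffle l r → Fin l → ℕ
rankˡ (left s)  zero    = 0
rankˡ (left s)  (suc a) = suc (rankˡ s a)
rankˡ (right s) a       = suc (rankˡ s a)

rankʳ : Shuffle l r → Fin r → ℕ
rankʳ (left s)  b       = suc (rankʳ s b)
rankʳ (right s) zero    = 0
rankʳ (right s) (suc b) = suc (rankʳ s b)

rankˡ-mono : (s : Shuffle l r) → ∀ {a b} → a Fin.< b → rankˡ s a < rankˡ s b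
rankˡ-mono (left s)  {zero}  {suc b} _   = z<s
rankˡ-mono (left s)  {suc a} {suc b} a<b = s<s (rankˡ-mono s (s<s⁻¹ a<b))
rankˡ-mono (right s)                 a<b = s<s (rankˡ-mono s a<b)

rankʳ-mono : (s : Shuffle l r) → ∀ {a b} → a Fin.< b → rankʳ s a < rankʳ s b
rankʳ-mono (right s) {zero}  {suc b} _   = z<s
rankʳ-mono (right s) {suc a} {suc b} a<b = s<s (rankʳ-mono s (s<s⁻¹ a<b))
rankʳ-mono (left s)                  a<b = s<s (rankʳ-mono s a<b)

rankˡ≢rankʳ : (s : Shuffle l r) → ∀ a b → rankˡ s a ≢ rankʳ s b
rankˡ≢rankʳ (left s)  (suc a) b       eq = rankˡ≢rankʳ s a b (ℕ.suc-injective eq)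
rankˡ≢rankʳ (right s) a       (suc b) eq = rankˡ≢rankʳ s a b (ℕ.suc-injective eq)

-- Where `s` and `t` first differ, one puts the head of the left chain first and the other the head
-- of the right chain, so comparing these two heads tells them apart.
rank-unique : (s t : Shuffle l r) →
  (∀ a b → rankˡ s a < rankʳ s b → rankˡ t a < rankʳ t b) →
  (∀ a b → rankˡ t a < rankʳ t b → rankˡ s a < rankʳ s b) →
  s ≡ t
rank-unique []        []        _   _   = refl
rank-unique (left s)  (left t)  s⇒t t⇒s = cong left (rank-unique s t
  (λ a b → s<s⁻¹ ∘ s⇒t (suc a) b ∘ s<s) (λ a b → s<s⁻¹ ∘ t⇒s (suc a) b ∘ s<s))
rank-unique (right s) (right t) s⇒t t⇒s = cong right (rank-unique s t
  (λ a b → s<s⁻¹ ∘ s⇒t a (suc b) ∘ s<s) (λ a b → s<s⁻¹ ∘ t⇒s a (suc b) ∘ s<s))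
rank-unique (left s)  (right t) s⇒t _   = case s⇒t zero zero z<s of λ ()
rank-unique (right s) (left t)  _   t⇒s = case t⇒s zero zero z<s of λ ()

-- R zero zero decides which side's nearest alternative comes first: if it holds,
-- monotonicity gives R zero b for all b, and otherwise R a zero fails for all a.
shuffleOf : ∀ l r {R : Fin l → Fin r → Set} → (∀ a b → Dec (R a b)) →
  (∀ {a a′ b} → a′ Fin.< a → R a b → R a′ b) →
  (∀ {a b b′} → b Fin.< b′ → R a b → R a b′) →
  ∃ λ (s : Shuffle l r) →
    ∀ a b → (rankˡ s a < rankʳ s b → R a b) × (rankʳ s b < rankˡ s a → ¬ R a b)
shuffleOf zero    zero    R? down up = [] , λ ()
shuffleOf zero    (suc r) R? down up =
  let s , _ = shuffleOf zero r {λ ()} (λ ()) (λ { {()} }) (λ { {()} }) in right s , λ ()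
shuffleOf (suc l) zero    R? down up =
  let s , _ = shuffleOf l zero {λ _ ()} (λ _ ()) (λ { {b = ()} }) (λ { {b = ()} })
  in left s , λ _ ()
shuffleOf (suc l) (suc r) R? down up with R? zero zero
... | yes r₀₀ =
  let s , s-R = shuffleOf l (suc r) (R? ∘ suc) (down ∘ s<s) up in left s , λ
  { zero    zero    → (λ _ → r₀₀) , λ ()
  ; zero    (suc b) → (λ _ → up z<s r₀₀) , λ ()
  ; (suc a) b       → proj₁ (s-R a b) ∘ s<s⁻¹ , proj₂ (s-R a b) ∘ s<s⁻¹
  }
... | no ¬r₀₀ =
  let s , s-R = shuffleOf (suc l) r (λ a b → R? a (suc b)) down (up ∘ s<s) in right s , λ
  { zero    zero    → (λ ()) , λ _ → ¬r₀₀
  ; (suc a) zero    → (λ ()) , λ _ → ¬r₀₀ ∘ down z<s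
  ; a       (suc b) → proj₁ (s-R a b) ∘ s<s⁻¹ , proj₂ (s-R a b) ∘ s<s⁻¹
  }

-- Splitting the axis at a voter.

-- The alternatives as seen from a voter, both sides numbered in axis order: the
-- alternative next to the peak is above zero or below (opposite zero).
data Alternative (l r : ℕ) : Set where
  below : Fin l → Alternative l r
  peak  : Alternative l r
  above : Fin r → Alternative l r

locate : (i : Fin (suc m)) → Alternative (toℕ i) (m ∸ toℕ i) → Fin (suc m)
locate         zero    peak            = zero
locate         zero    (above b)       = suc b
locate {suc m} (suc i) (below zero)    = zero
locate {suc m} (suc i) (below (suc a)) = suc (locate i (below a))
locate {suc m} (suc i) peak            = suc (locate i peak)
locate {suc m} (suc i) (above b)       = suc (locate i (above b))

-- The effect of moving the voter one step up an axis that gains a new lowest alternative: only the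
-- numbering below the peak shifts.
raise : Alternative l r → Alternative (suc l) r
raise (below a) = below (suc a)
raise peak      = peak
raise (above b) = above b

view : (i : Fin (suc m)) → Fin (suc m) → Alternative (toℕ i) (m ∸ toℕ i)
view         zero    zero    = peak
view         zero    (suc x) = above x
view {suc m} (suc i) zero    = below zero
view {suc m} (suc i) (suc x) = raise (view i x)

locate-raise : (i : Fin (suc m)) → ∀ s → locate (suc i) (raise s) ≡ suc (locate i s)
locate-raise i (below a) = refl
locate-raise i peak      = refl
locate-raise i (above b) = refl

locate-view : (i x : Fin (suc m)) → locate i (view i x) ≡ x
locate-view         zero    zero    = refl
locate-view         zero    (suc x) = refl
locate-view {suc m} (suc i) zero    = refl
locate-view {suc m} (suc i) (suc x) =
  trans (locate-raise i (view i x)) (cong suc (locate-view i x))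

view-locate : (i : Fin (suc m)) → ∀ s → view i (locate i s) ≡ s
view-locate         zero    peak            = refl
view-locate         zero    (above b)       = refl
view-locate {suc m} (suc i) (below zero)    = refl
view-locate {suc m} (suc i) (below (suc a)) = cong raise (view-locate i (below a))
view-locate {suc m} (suc i) peak            = cong raise (view-locate i peak)
view-locate {suc m} (suc i) (above b)       = cong raise (view-locate i (above b))

view-injective : (i : Fin (suc m)) → ∀ {x y} → view i x ≡ view i y → x ≡ y
view-injective i {x} {y} eq =
  trans (sym (locate-view i x)) (trans (cong (locate i) eq) (locate-view i y))

locate-peak : (i : Fin (suc m)) → locate i peak ≡ i
locate-peak         zero    = refl
locate-peak {suc m} (suc i) = cong suc (locate-peak i)

view-peak : (i : Fin (suc m)) → view i i ≡ peak
view-peak i = trans (cong (view i) (sym (locate-peak i))) (view-locate i peak)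

locate-below-mono : (i : Fin (suc m)) → ∀ {a b} → a Fin.< b →
                    locate i (below a) Fin.< locate i (below b)
locate-below-mono {suc m} (suc i) {zero}  {suc b} _   = z<s
locate-below-mono {suc m} (suc i) {suc a} {suc b} a<b =
  s<s (locate-below-mono i (s<s⁻¹ a<b))

locate-above-mono : (i : Fin (suc m)) → ∀ {a b} → a Fin.< b →
                    locate i (above a) Fin.< locate i (above b)
locate-above-mono         zero    a<b = s<s a<b
locate-above-mono {suc m} (suc i) a<b = s<s (locate-above-mono i a<b)

locate-below< : (i : Fin (suc m)) → ∀ a → locate i (below a) Fin.< i
locate-below< {suc m} (suc i) zero    = z<s
locate-below< {suc m} (suc i) (suc a) = s<s (locate-below< i a)

<locate-above : (i : Fin (suc m)) → ∀ b → i Fin.< locate i (above b)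
<locate-above         zero    b = z<s
<locate-above {suc m} (suc i) b = s<s (<locate-above i b)

<⇒below : (i : Fin (suc m)) → ∀ {x} → x Fin.< i → ∃ λ a → x ≡ locate i (below a)
<⇒below {suc m} (suc i) {zero}  _   = zero , refl
<⇒below {suc m} (suc i) {suc x} x<i =
  let a , eq = <⇒below i (s<s⁻¹ x<i) in suc a , cong suc eq

>⇒above : (i : Fin (suc m)) → ∀ {x} → i Fin.< x → ∃ λ b → x ≡ locate i (above b)
>⇒above         zero    {suc x} _   = x , refl
>⇒above {suc m} (suc i) {suc x} i<x =
  let b , eq = >⇒above i (s<s⁻¹ i<x) in b , cong suc eq

-- From shuffles to single-peaked orders.

-- The peak takes rank 0, which shifts all other ranks by one. `opposite` is needed because the
-- lower side is numbered along the axis, while the shuffle counts from the peak outwards.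
rank : Shuffle l r → Alternative l r → ℕ
rank s (below a) = suc (rankˡ s (opposite a))
rank s peak      = 0
rank s (above b) = suc (rankʳ s b)

rank-injective : (s : Shuffle l r) → ∀ {x y} → rank s x ≡ rank s y → x ≡ y
rank-injective s {below a} {below b} eq = cong below (opposite-injective
  (mono⇒injective (rankˡ s) (rankˡ-mono s) (ℕ.suc-injective eq)))
rank-injective s {below a} {above b} eq =
  contradiction (ℕ.suc-injective eq) (rankˡ≢rankʳ s (opposite a) b)
rank-injective s {peak}    {peak}    _  = refl
rank-injective s {above a} {below b} eq =
  contradiction (sym (ℕ.suc-injective eq)) (rankˡ≢rankʳ s (opposite b) a)
rank-injective s {above a} {above b} eq =
  cong above (mono⇒injective (rankʳ s) (rankʳ-mono s) (ℕ.suc-injective eq))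

byRank : (f : Fin n → ℕ) → (∀ {x y} → f x ≡ f y → x ≡ y) → LinearOrder n
byRank f f-injective = record
  { _≻_                = λ x y → f x < f y
  ; isStrictTotalOrder = OrderMonomorphism.isStrictTotalOrder
      (record
        { isOrderHomomorphism = record { cong = cong f ; mono = id }
        ; injective           = f-injective
        ; cancel              = id
        })
      ℕ.<-isStrictTotalOrder
  }

-- A strict total order is maximal under inclusion: a pair missing from `P` is reversed there, so
-- its reverse lies in `Q`, against asymmetry. Thus one inclusion suffices to identify two orders.
⊆⇒⊇ : (P Q : LinearOrder n) (let open LinearOrder) →
      (∀ {x y} → _≻_ P x y → _≻_ Q x y) → ∀ {x y} → _≻_ Q x y → _≻_ P x y
⊆⇒⊇ P Q P⊆Q {x} {y} x≻y with LinearOrder.compare P x y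
... | tri< x≻ᴾy _ _ = x≻ᴾy
... | tri≈ _ refl _ = contradiction x≻y (LinearOrder.asym Q x≻y)
... | tri> _ _ y≻ᴾx = contradiction x≻y (LinearOrder.asym Q (P⊆Q y≻ᴾx))

module _ (i : Fin (suc m)) where

  private
    i-Shuffle : Set
    i-Shuffle = Shuffle (toℕ i) (m ∸ toℕ i)

  order : i-Shuffle → PreferenceOrder (suc m)
  order s = byRank (rank s ∘ view i) (view-injective i ∘ rank-injective s)

  order-locate : ∀ s x y → LinearOrder._≻_ (order s) (locate i x) (locate i y) →
                 rank s x < rank s y
  order-locate s x y = subst₂ (λ u v → rank s u < rank s v) (view-locate i x) (view-locate i y)

  locate-order : ∀ s x y → rank s x < rank s y →
                 LinearOrder._≻_ (order s) (locate i x) (locate i y)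
  locate-order s x y =
    subst₂ (λ u v → rank s u < rank s v) (sym (view-locate i x)) (sym (view-locate i y))

  order-peak : ∀ s → IsPeak (order s) i
  -- Rank 0 is minimal; injectivity of the ranks makes the inequality strict.
  order-peak s {a} a≢i = ℕ.≤∧≢⇒<
    (subst (λ u → rank s u ≤ rank s (view i a)) (sym (view-peak i)) z≤n)
    (a≢i ∘ sym ∘ view-injective i ∘ rank-injective s)

  order-singlePeaked : ∀ s → SinglePeakedOrder (naturalAxis (suc m)) (order s)
  order-singlePeaked s p-peak a b sides
    -- Single-peakedness speaks of an arbitrary peak; uniqueness of the peak identifies it with `i`.
    with refl ← trans (sym (proj₂ (proj₂ (peak! (order s))) (λ {x} → order-peak s {x})))
                      (proj₂ (proj₂ (peak! (order s))) (λ {x} → p-peak {x}))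
    with sides
  -- Both alternatives lie on the same side of `i`, so their order on the axis cancels to an order
  -- of their numbers, reversed here because the lower chain runs away from the peak.
  ... | inj₁ (a<b , b<i)
    with u , refl ← <⇒below i (ℕ.<-trans a<b b<i) | v , refl ← <⇒below i b<i =
    locate-order s (below v) (below u) (s<s (rankˡ-mono s (opposite-anti-<
      (mono⇒cancel (toℕ ∘ locate i ∘ below) (locate-below-mono i) a<b))))
  ... | inj₂ (i<b , b<a)
    with u , refl ← >⇒above i (ℕ.<-trans i<b b<a) | v , refl ← >⇒above i i<b =
    locate-order s (above v) (above u) (s<s (rankʳ-mono s
      (mono⇒cancel (toℕ ∘ locate i ∘ above) (locate-above-mono i) b<a)))

  -- Supplies the cross comparisons that `rank-unique` asks for; `opposite` translates between
  -- distance from the peak and axis numbering.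
  order-⊆⇒rank : ∀ s t →
    (∀ {x y} → LinearOrder._≻_ (order s) x y → LinearOrder._≻_ (order t) x y) →
    ∀ a b → rankˡ s a < rankʳ s b → rankˡ t a < rankʳ t b
  order-⊆⇒rank s t s⊆t a b lt =
    subst (λ c → rankˡ t c < rankʳ t b) (opposite-involutive a)
      (s<s⁻¹ (order-locate t (below (opposite a)) (above b) (s⊆t
        (locate-order s (below (opposite a)) (above b)
          (s<s (subst (λ c → rankˡ s c < rankʳ s b) (sym (opposite-involutive a)) lt))))))

  order-injective : ∀ {s t} →
    (∀ {x y} → LinearOrder._≻_ (order s) x y → LinearOrder._≻_ (order t) x y) →
    (∀ {x y} → LinearOrder._≻_ (order t) x y → LinearOrder._≻_ (order s) x y) →
    s ≡ t
  order-injective {s} {t} s⊆t t⊆s =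
    rank-unique s t (order-⊆⇒rank s t s⊆t) (order-⊆⇒rank t s t⊆s)

  -- From single-peaked orders back to shuffles.

  module _ (P : PreferenceOrder (suc m)) (i-peak : IsPeak P i)
           (singlePeaked : SinglePeakedOrder (naturalAxis (suc m)) P) where

    open LinearOrder P renaming (trans to ≻-trans; asym to ≻-asym)

    private
      _≻ᵛ_ : (x y : Alternative (toℕ i) (m ∸ toℕ i)) → Set
      x ≻ᵛ y = locate i x ≻ locate i y

      below-≻ : ∀ {a b} → a Fin.< b → below b ≻ᵛ below a
      below-≻ {a} {b} a<b = singlePeaked (λ {x} → i-peak {x}) _ _
        (inj₁ (locate-below-mono i a<b , locate-below< i b))

      above-≻ : ∀ {a b} → a Fin.< b → above a ≻ᵛ above b
      above-≻ {a} {b} a<b = singlePeaked (λ {x} → i-peak {x}) _ _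
        (inj₂ (<locate-above i a , locate-above-mono i a<b))

      -- Here `a` counts outwards from the peak, the convention of `shuffleOf`.
      R : Fin (toℕ i) → Fin (m ∸ toℕ i) → Set
      R a b = below (opposite a) ≻ᵛ above b

      R? : ∀ a b → Dec (R a b)
      R? a b with compare (locate i (below (opposite a))) (locate i (above b))
      ... | tri< a≻b _ _ = yes a≻b
      ... | tri≈ a⊁b _ _ = no a⊁b
      ... | tri> a⊁b _ _ = no a⊁b

      shuffle : ∃ λ (s : i-Shuffle) →
        ∀ a b → (rankˡ s a < rankʳ s b → R a b) × (rankʳ s b < rankˡ s a → ¬ R a b)
      shuffle = shuffleOf (toℕ i) (m ∸ toℕ i) R?
        -- On each side nearer alternatives are preferred, so `R` survives bringing the lower
        -- alternative closer or moving the upper one away.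
        (λ a′<a → ≻-trans (below-≻ (opposite-anti-< a′<a)))
        (λ b<b′ a≻b → ≻-trans a≻b (above-≻ b<b′))

      s : i-Shuffle
      s = proj₁ shuffle

      -- Two alternatives on the same side are ordered by single-peakedness, the peak beats
      -- everything, and opposite sides are settled by the choice of `s`.
      rank⇒≻ : ∀ x y → rank s x < rank s y → x ≻ᵛ y
      rank⇒≻ (below a) (below b) lt = below-≻ (opposite-cancel-<
        (mono⇒cancel (rankˡ s) (rankˡ-mono s) (s<s⁻¹ lt)))
      rank⇒≻ (below a) (above b) lt =
        subst (λ c → below c ≻ᵛ above b) (opposite-involutive a)
          (proj₁ (proj₂ shuffle (opposite a) b) (s<s⁻¹ lt))
      rank⇒≻ peak      (below b) _  rewrite locate-peak i =
        i-peak (ℕ.<⇒≢ (locate-below< i b) ∘ cong toℕ)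
      rank⇒≻ peak      (above b) _  rewrite locate-peak i =
        i-peak (ℕ.>⇒≢ (<locate-above i b) ∘ cong toℕ)
      -- The shuffle only refutes the preference for `below b`. Totality yields the converse,
      -- equality being impossible since the two lie on different sides of `i`.
      rank⇒≻ (above a) (below b) lt
        with compare (locate i (above a)) (locate i (below b))
      ... | tri< a≻b _ _ = a≻b
      ... | tri≈ _ a≡b _ = contradiction (cong toℕ a≡b)
        (ℕ.>⇒≢ (ℕ.<-trans (locate-below< i b) (<locate-above i a)))
      ... | tri> _ _ b≻a = contradiction
        (subst (λ c → below c ≻ᵛ above a) (sym (opposite-involutive b)) b≻a)
        (proj₂ (proj₂ shuffle (opposite b) a) (s<s⁻¹ lt))
      rank⇒≻ (above a) (above b) lt =
        above-≻ (mono⇒cancel (rankʳ s) (rankʳ-mono s) (s<s⁻¹ lt))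

      order⊆P : ∀ {x y} → LinearOrder._≻_ (order s) x y → x ≻ y
      order⊆P {x} {y} lt =
        subst₂ _≻_ (locate-view i x) (locate-view i y) (rank⇒≻ (view i x) (view i y) lt)

    order-surjective : ∃ λ t →
      (∀ {x y} → LinearOrder._≻_ (order t) x y → x ≻ y) ×
      (∀ {x y} → x ≻ y → LinearOrder._≻_ (order t) x y)
    order-surjective = s , order⊆P , ⊆⇒⊇ (order s) P order⊆P

-- Counting independent choices.

-- The mixed-radix digits of a number, with base `f i` at position `i`, most significant first.
-- Digit families are compared pointwise below, which avoids function extensionality.
choices : ∀ (f : ℕ → ℕ) n → Fin (product (applyUpTo f n)) → (i : Fin n) → Fin (f (toℕ i))
choices f (suc n) k zero    = proj₁ (remQuot {f 0} (product (applyUpTo (f ∘ suc) n)) k)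
choices f (suc n) k (suc i) =
  choices (f ∘ suc) n (proj₂ (remQuot {f 0} (product (applyUpTo (f ∘ suc) n)) k)) i

choices-injective : ∀ f n {k k′} → (∀ i → choices f n k i ≡ choices f n k′ i) → k ≡ k′
choices-injective f zero    {zero} {zero} _  = refl
choices-injective f (suc n) {k}    {k′}   eq = begin
  k                              ≡⟨ combine-remQuot {f 0} N k ⟨
  combine (proj₁ (remQuot {f 0} N k)) (proj₂ (remQuot {f 0} N k))
    ≡⟨ cong₂ combine (eq zero) (choices-injective (f ∘ suc) n (eq ∘ suc)) ⟩
  combine (proj₁ (remQuot {f 0} N k′)) (proj₂ (remQuot {f 0} N k′))
                                 ≡⟨ combine-remQuot {f 0} N k′ ⟩
  k′                             ∎
  where
  open ≡-Reasoning
  N = product (applyUpTo (f ∘ suc) n)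

choices-surjective : ∀ f n (c : (i : Fin n) → Fin (f (toℕ i))) →
                     ∃ λ k → ∀ i → choices f n k i ≡ c i
choices-surjective f zero    c = zero , λ ()
choices-surjective f (suc n) c =
  let k , eq = choices-surjective (f ∘ suc) n (c ∘ suc) in
  combine (c zero) k , λ
  { zero    → cong proj₁ (remQuot-combine (c zero) k)
  ; (suc i) → trans
      (cong (λ q → choices (f ∘ suc) n (proj₂ q) i) (remQuot-combine (c zero) k)) (eq i)
  }

-- The sides have `toℕ i` and `m ∸ toℕ i` elements, `m` together. As voters are numbered from 0,
-- this is the factor (n-1) C (i-1) of the 1-based count.
C↔Shuffle : (i : Fin (suc m)) → Fin (m C toℕ i) ↔ Shuffle (toℕ i) (m ∸ toℕ i)
C↔Shuffle {m} i = subst (λ k → Fin k ↔ Shuffle (toℕ i) (m ∸ toℕ i))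
  (trans (countShuffles≡C (toℕ i) (m ∸ toℕ i))
         (cong (_C toℕ i) (m+[n∸m]≡n (toℕ≤pred[n] i))))
  (Fin↔Shuffle (toℕ i) (m ∸ toℕ i))

profiles-cardinality : ∀ m →
  HasCardinality (narcissisticSinglePeakedProfiles (suc m) (naturalAxis (suc m)))
                 (product (applyUpTo (m C_) (suc m)))
profiles-cardinality m = record
  { to        = λ k → (λ i → order i (shuffle k i))
                    , (λ i → order-peak i (shuffle k i))
                    , (λ i → order-singlePeaked i (shuffle k i))
  ; cong      = λ { refl i → id , id }
  ; bijective = (λ eq → choices-injective (m C_) (suc m) (λ i → Injection.injective (↔⇒↣ (C↔Shuffle i))
                    (order-injective i (proj₁ (eq i)) (proj₂ (eq i)))))
              , surj
  }
  where
  shuffle : Fin (product (applyUpTo (m C_) (suc m))) →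
            (i : Fin (suc m)) → Shuffle (toℕ i) (m ∸ toℕ i)
  shuffle k i = Inverse.to (C↔Shuffle i) (choices (m C_) (suc m) k i)

  surj : _
  surj (Ps , narcissistic , singlePeaked) = k , λ
    -- Decoding `k` returns the shuffle of `Ps i` only up to `k-shuffle`, so the equivalence of
    -- orders is transported along it.
    { refl i → subst
        (λ t → (∀ {x y} → LinearOrder._≻_ (order i t) x y → LinearOrder._≻_ (Ps i) x y)
             × (∀ {x y} → LinearOrder._≻_ (Ps i) x y → LinearOrder._≻_ (order i t) x y))
        (sym (k-shuffle i)) (proj₂ (pre i)) }
    where
    pre = λ i → order-surjective i (Ps i) (λ {x} → narcissistic i {x}) (singlePeaked i)
    code = choices-surjective (m C_) (suc m) (λ i → Inverse.from (C↔Shuffle i) (proj₁ (pre i)))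
    k = proj₁ code
    k-shuffle : ∀ i → shuffle k i ≡ proj₁ (pre i)
    k-shuffle i = trans (cong (Inverse.to (C↔Shuffle i)) (proj₂ code i))
                        (Inverse.strictlyInverseˡ (C↔Shuffle i) (proj₁ (pre i)))

-- Removing the factors of the two extreme voters.

product-dropEnds : ∀ k →
  product (applyUpTo (suc k C_) (2 + k)) ≡ ∏[ 2 ⋯ suc k ] (λ i → suc k C (i ∸ 1))
product-dropEnds k = begin
  -- The first factor, `suc k C 0`, already computes to 1; the last one, `g k`, is `suc k C suc k`
  -- and is split off at the end of the list.
  1 * product (applyUpTo g (suc k))       ≡⟨ ℕ.*-identityˡ _ ⟩
  product (applyUpTo g (suc k))           ≡⟨ cong product (applyUpTo-∷ʳ g k) ⟨
  product (applyUpTo g k ∷ʳ g k)          ≡⟨ product-++ (applyUpTo g k) (g k ∷ []) ⟩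
  product (applyUpTo g k) * (g k * 1)
    ≡⟨ cong (λ c → product (applyUpTo g k) * (c * 1)) (nCn≡1 (suc k)) ⟩
  product (applyUpTo g k) * 1             ≡⟨ *-identityʳ _ ⟩
  product (applyUpTo g k)
    ≡⟨ cong product (map-applyUpTo (2 +_) (λ i → suc k C (i ∸ 1)) k) ⟨
  product (map (λ i → suc k C (i ∸ 1)) (applyUpTo (2 +_) k)) ∎
  where
  open ≡-Reasoning
  g = λ j → suc k C suc j

theorem2 : (n : ℕ) → 2 ≤ n →
    HasCardinality (narcissisticSinglePeakedProfiles n (naturalAxis n))
    (∏[ 2 ⋯ n ∸ 1 ] (λ i → (n ∸ 1) C (i ∸ 1)))
theorem2 (suc (suc k)) (s≤s (s≤s z≤n)) =
  subst (HasCardinality _) (product-dropEnds k) (profiles-cardinality (suc k))
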